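{- Let $G$ be a chordal claw-free graph (finite and simple). Then $G$ is narrow if and only if it is net-free or tent-free.
   Context: Graphs are finite, simple and undirected, with vertex set $V(G)$ and edge set $E(G)$. Chordal: every cycle of $G$ on four or more vertices has a chord, i.e. an edge joining two vertices that are non-adjacent in the cycle. Claw-free, net-free, tent-free: $G$ does not contain as an induced subgraph the claw, the net, the tent, respectively, where: - the claw is the graph on four vertices $o,p,q,r$ with edges $\{o,p\},\{o,q\},\{o,r\}$; - the net is the graph on six vertices $a,b,c,x,y,z$ with edges $\{a,b\},\{b,c\},\{a,c\},\{a,x\},\{b,y\},\{c,z\}$; - the tent is the graph on six vertices $a,b,c,d,e,f$ with edges $\{b,c\},\{c,e\},\{b,e\},\{a,b\},\{a,c\},\{c,d\},\{d,e\},\{b,f\},\{e,f\}$. Distance and diameter: $d(u,v)$ is the length (number of edges) of a shortest path connecting the vertices $u$ and $v$ of $G$, and $\operatorname{diam}(G)$ is the maximum distance between two vertices of $G$. Given vertices $v,w$ of $G$ with $d(v,w)=\operatorname{diam}(G)$, a shortest path connecting $v$ and $w$ is called a longest shortest path of $G$. Narrow: $G$ is narrow if for every $v\in V(G)$ and every longest shortest path $P$ of $G$, either $v\in V(P)$ or there is $w\in V(P)$ with $\{v,w\}\in E(G)$. In other words, a connected graph is narrow if every vertex is at distance at most one from every longest shortest path.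
   Formalization: Proved for connected G, with "net-free and tent-free" in place of "net-free or tent-free": the net itself is chordal, claw-free and tent-free but not narrow, and for disconnected graphs distance and diameter are undefined (K1 ⊔ K2 is a counterexample with finite distances). -}

module Defs where

open import Data.Fin using (Fin; zero; suc; toℕ; fromℕ; inject₁; #_)
open import Data.Fin.Properties using (_≟_)
open import Data.List using (List; []; _∷_)
open import Data.List.Membership.Propositional using (_∈_)
import Data.List.Membership.DecPropositional as DecMembership
open import Data.List.Relation.Unary.All using (All; lookup; all?)
open import Data.Nat using (ℕ; suc; _≤_)
open import Data.Product using (Σ-syntax; ∃-syntax; _×_; _,_; uncurry)
open import Data.Product.Properties using (≡-dec)
open import Data.Sum using (_⊎_; inj₁; inj₂; swap)
open import Function.Bundles using (_⇔_)
open import Function.Definitions using (Injective)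
open import Level using (0ℓ)
open import Relation.Binary.Core using (Rel)
open import Relation.Binary.Definitions using (Decidable; Symmetric)
open import Relation.Binary.PropositionalEquality using (_≡_; _≢_; refl)
open import Relation.Nullary using (Dec; ¬_; ¬?; _⊎-dec_)
open import Relation.Nullary.Decidable using (from-yes)

-- Finiteness is expressed by numbering the vertices; decidability of
-- adjacency is part of what it means for a graph to be given finitely.
record Graph : Set₁ where
  field
    order : ℕ

  V : Set
  V = Fin order

  field
    Adj     : Rel V 0ℓ
    adj?    : Decidable Adj
    adj-sym : Symmetric Adj
    no-loop : ∀ v → ¬ Adj v v

------------------------------------------------------------------------
-- Paths, cycles, distance

module _ (G : Graph) where
  open Graph G

  -- A path with ℓ edges, hence ℓ + 1 pairwise distinct vertices.
  record Path (u v : V) (ℓ : ℕ) : Set where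
    field
      vertex   : Fin (suc ℓ) → V
      distinct : Injective _≡_ _≡_ vertex
      start    : vertex zero ≡ u
      end      : vertex (fromℕ ℓ) ≡ v
      step     : (i : Fin ℓ) → Adj (vertex (inject₁ i)) (vertex (suc i))

  -- A cycle on m + 1 vertices; a genuine cycle only for m ≥ 2.
  record Cycle (m : ℕ) : Set where
    field
      vertex   : Fin (suc m) → V
      distinct : Injective _≡_ _≡_ vertex
      step     : (i : Fin m) → Adj (vertex (inject₁ i)) (vertex (suc i))
      close    : Adj (vertex (fromℕ m)) (vertex zero)

  Connected : Set
  Connected = ∀ u v → ∃[ ℓ ] Path u v ℓ

  Distance : V → V → ℕ → Set
  Distance u v d = Path u v d × (∀ ℓ → Path u v ℓ → d ≤ ℓ)

  -- The maximum of the distances, as intended for connected graphs.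
  Diameter : ℕ → Set
  Diameter D =
    (∃[ u ] ∃[ v ] Distance u v D) × (∀ u v d → Distance u v d → d ≤ D)

  -- P : Path v w D with d(v,w) = D = diam(G); P is then a shortest path
  -- because its length is the distance of its ends.
  LongestShortest : ∀ {v w D} → Path v w D → Set
  LongestShortest {v} {w} {D} P = Distance v w D × Diameter D

  OnPath : ∀ {u v ℓ} → V → Path u v ℓ → Set
  OnPath x P = ∃[ i ] Path.vertex P i ≡ x

  Narrow : Set
  Narrow = ∀ (x : V) {v w D} (P : Path v w D) → LongestShortest P →
           OnPath x P ⊎ (∃[ y ] OnPath y P × Adj x y)

------------------------------------------------------------------------
-- Chordality

-- Positions i and j of a cycle on m + 1 vertices such that j follows i.
Follows : ∀ {m} → Fin (suc m) → Fin (suc m) → Set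
Follows {m} i j = toℕ j ≡ suc (toℕ i) ⊎ (i ≡ fromℕ m × j ≡ zero)

HasChord : (G : Graph) → ∀ {m} → Cycle G m → Set
HasChord G C =
  ∃[ i ] ∃[ j ] ¬ Follows i j × ¬ Follows j i × Adj (vertex i) (vertex j)
  where
  open Graph G
  open Cycle C

Chordal : Graph → Set
Chordal G = ∀ m → 4 ≤ suc m → (C : Cycle G m) → HasChord G C

------------------------------------------------------------------------
-- Forbidden induced subgraphs

ContainsInduced : Graph → Graph → Set
ContainsInduced G H =
  Σ[ f ∈ (V H → V G) ] Injective _≡_ _≡_ f ×
    (∀ i j → Adj H i j ⇔ Adj G (f i) (f j))
  where open Graph

_-free_ : Graph → Graph → Set
H -free G = ¬ ContainsInduced G H

fromEdges : (n : ℕ) (es : List (Fin n × Fin n)) → All (uncurry _≢_) es → Graph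
fromEdges n es loopless = record
  { order   = n
  ; Adj     = λ u v → (u , v) ∈ es ⊎ (v , u) ∈ es
  ; adj?    = λ u v → ((u , v) ∈? es) ⊎-dec ((v , u) ∈? es)
  ; adj-sym = swap
  ; no-loop = λ where
      v (inj₁ p) → lookup loopless p refl
      v (inj₂ p) → lookup loopless p refl
  }
  where open DecMembership (≡-dec (_≟_ {n}) (_≟_ {n})) using (_∈?_)

loopless? : ∀ {n} (es : List (Fin n × Fin n)) → Dec (All (uncurry _≢_) es)
loopless? es = all? (λ (u , v) → ¬? (u ≟ v)) es

-- o , p , q , r = 0 , 1 , 2 , 3
clawEdges : List (Fin 4 × Fin 4)
clawEdges = (# 0 , # 1) ∷ (# 0 , # 2) ∷ (# 0 , # 3) ∷ []

-- a , b , c , x , y , z = 0 , 1 , 2 , 3 , 4 , 5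
netEdges : List (Fin 6 × Fin 6)
netEdges =
  (# 0 , # 1) ∷ (# 1 , # 2) ∷ (# 0 , # 2) ∷
  (# 0 , # 3) ∷ (# 1 , # 4) ∷ (# 2 , # 5) ∷ []

-- a , b , c , d , e , f = 0 , 1 , 2 , 3 , 4 , 5
tentEdges : List (Fin 6 × Fin 6)
tentEdges =
  (# 1 , # 2) ∷ (# 2 , # 4) ∷ (# 1 , # 4) ∷
  (# 0 , # 1) ∷ (# 0 , # 2) ∷ (# 2 , # 3) ∷
  (# 3 , # 4) ∷ (# 1 , # 5) ∷ (# 4 , # 5) ∷ []

claw net tent : Graph
claw = fromEdges 4 clawEdges (from-yes (loopless? clawEdges))
net  = fromEdges 6 netEdges  (from-yes (loopless? netEdges))
tent = fromEdges 6 tentEdges (from-yes (loopless? tentEdges))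

ClawFree NetFree TentFree : Graph → Set
ClawFree G = claw -free G
NetFree  G = net -free G
TentFree G = tent -free G

{-# OPTIONS --safe #-}
-- Work with the layers given by the distance from a fixed vertex s.  In a
-- chordal graph two vertices of one layer that are joined through higher
-- layers are equal or adjacent, so an edge inside a layer has a common
-- neighbour in the layer below.
--
-- If G is net- and tent-free, take a longest shortest path P and an edge yx
-- with x undominated and y adjacent to P.  Claw-freeness makes y adjacent to
-- two consecutive vertices of P, which gives a net, unless y is adjacent to an
-- end of P; there the layers from the other end yield a claw, a tent, or a
-- neighbour of x on P.
--
-- If G is narrow, then all layers from layer 2 on are cliques when s is an end
-- of a longest shortest path.  Among the vertices farthest from s, one with
-- minimal closed neighbourhood is simplicial, and all layers from it are
-- cliques.  A graph in which every layer is a clique contains neither net nor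
-- tent: the three pairwise non-adjacent vertices would have to lie in three
-- different layers.
module Submission where

open import Defs
open import Data.Empty using (⊥; ⊥-elim)
open import Data.Fin using (Fin; zero; suc; toℕ; fromℕ; fromℕ<; inject₁; opposite; #_)
open import Data.Fin.Induction using (<-weakInduction)
import Data.Fin.Properties as Fin
open import Data.Fin.Subset as Subset using (Subset; _⊂_)
open import Data.Fin.Subset.Induction using (⊂-wellFounded)
open import Data.List using (List; []; _∷_; allFin; cartesianProduct)
open import Data.List.Membership.Propositional using (_∈_)
open import Data.List.Membership.Propositional.Properties using (∈-allFin; ∈-cartesianProduct⁺)
import Data.List.Membership.DecPropositional as DecMembership
open import Data.List.Relation.Unary.All as All using (All; []; _∷_)
open import Data.Nat
open import Data.Nat.Induction using (Acc; acc; <-wellFounded)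
open import Data.Nat.Properties
open import Data.List.Extrema ≤-totalOrder using (argmax; f[xs]≤f[argmax])
open import Data.Product using (_×_; _,_; ∃-syntax; proj₁; proj₂; uncurry)
open import Data.Product.Properties using (≡-dec)
open import Data.Sum using (_⊎_; inj₁; inj₂)
open import Data.Vec using (Vec; []; _∷_; lookup; tabulate)
open import Data.Vec.Properties using (lookup∘tabulate; lookup⇒[]=; []=⇒lookup)
open import Function.Bundles using (_⇔_; mk⇔; Equivalence)
open import Relation.Binary.Definitions using (tri<; tri≈; tri>)
open import Relation.Binary.PropositionalEquality
open import Relation.Nullary using (Dec; yes; no; does; ¬_; ¬?; _×-dec_; _⊎-dec_; contradiction)
open import Relation.Nullary.Decidable using (from-yes; True; False; toWitness; toWitnessFalse; dec-true; dec-false; decidable-stable)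

-- Splicing of sequences, and walks.

splice : {A : Set} → ℕ → (ℕ → A) → (ℕ → A) → ℕ → A
splice i f g k with k ≤? i
... | yes _ = f k
... | no  _ = g k

module _ {A : Set} (f g : ℕ → A) {i : ℕ} where

  splice-≤ : ∀ {k} → k ≤ i → splice i f g k ≡ f k
  splice-≤ {k} k≤i with k ≤? i
  ... | yes _  = refl
  ... | no k≰i = contradiction k≤i k≰i

  splice-> : ∀ {k} → i < k → splice i f g k ≡ g k
  splice-> {k} i<k with k ≤? i
  ... | yes k≤i = contradiction k≤i (<⇒≱ i<k)
  ... | no _    = refl

module _ (G : Graph) where
  open Graph G

  -- A walk is a sequence on all of `ℕ` of which only the values up to `n` matter, so that walks can
  -- be cut and spliced freely.
  IsWalk : ℕ → (ℕ → V) → Set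
  IsWalk n f = ∀ {k} → k < n → Adj (f k) (f (suc k))

  splice-walk : ∀ {i n f g} → IsWalk i f → Adj (f i) (g (suc i)) →
                (∀ {k} → i < k → k < n → Adj (g k) (g (suc k))) →
                IsWalk n (splice i f g)
  splice-walk {i} {f = f} {g} wf e wg {k} k<n with <-cmp k i
  ... | tri< k<i _ _ =
    subst₂ Adj (sym (splice-≤ f g (<⇒≤ k<i))) (sym (splice-≤ f g k<i)) (wf k<i)
  ... | tri≈ _ refl _ =
    subst₂ Adj (sym (splice-≤ f g {i} ≤-refl)) (sym (splice-> f g {i} ≤-refl)) e
  ... | tri> _ _ i<k =
    subst₂ Adj (sym (splice-> f g i<k)) (sym (splice-> f g (m≤n⇒m≤1+n i<k)))
               (wg i<k k<n)

  Close : V → V → Set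
  Close u v = u ≡ v ⊎ Adj u v

  close? : ∀ u v → Dec (Close u v)
  close? u v = (u Fin.≟ v) ⊎-dec adj? u v

  close-sym : ∀ {u v} → Close u v → Close v u
  close-sym (inj₁ eq) = inj₁ (sym eq)
  close-sym (inj₂ e)  = inj₂ (adj-sym e)

  MeetsInterior : V → ℕ → (ℕ → V) → Set
  MeetsInterior z n f = ∃[ k ] 0 < k × k < n × Close z (f k)

  -- Chordality for closed walks through a vertex.

  module _ (chordal : Chordal G) where

    private
      -- The walk may repeat vertices and may pass through `z`, so closing it up through `z` need
      -- not give a cycle.
      record Fan (z : V) (n : ℕ) (f : ℕ → V) : Set where
        field
          walk   : IsWalk n f
          first  : Adj z (f 0)
          last   : Adj z (f n)
          apart  : f 0 ≢ f n
          nonadj : ¬ Adj (f 0) (f n)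

      -- `rec` is the induction hypothesis for shorter walks.
      module _ {z n f} (fan : Fan z n f)
               (rec : ∀ {n′ f′} → n′ < n → Fan z n′ f′ → MeetsInterior z n′ f′)
               where
        open Fan fan

        -- Dropping the `c` vertices strictly between positions `a` and `b` leaves a shorter fan
        -- with the same two ends, and its interior vertices are interior to the old walk.
        shortcut : ∀ {a b} → a < b → b ≤ n → b ≢ suc a → Adj (f a) (f b) →
                   MeetsInterior z n f
        shortcut {a} {b} a<b b≤n b≢1+a e = back (rec n′<n fan′)
          where
          c n′ : ℕ
          c  = b ∸ suc a
          n′ = n ∸ c
          b≡ : suc a + c ≡ b
          b≡ = m+[n∸m]≡n a<b
          0<c : 0 < c
          0<c = m<n⇒0<n∸m (≤∧≢⇒< a<b (λ eq → b≢1+a (sym eq)))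
          c≤n : c ≤ n
          c≤n = ≤-trans (m∸n≤m b (suc a)) b≤n
          n′+c : n′ + c ≡ n
          n′+c = m∸n+n≡m c≤n
          a<n′ : a < n′
          a<n′ = +-cancelʳ-≤ c (suc a) n′ (subst₂ _≤_ (sym b≡) (sym n′+c) b≤n)
          n′<n : n′ < n
          n′<n = subst (n′ <_) n′+c (m<m+n n′ 0<c)
          shift : ∀ {k} → k < n′ → k + c < n
          shift {k} k<n′ = subst (k + c <_) n′+c (+-monoˡ-< c k<n′)
          g f′ : ℕ → V
          g k = f (k + c)
          f′ = splice a f g
          f′0 : f′ 0 ≡ f 0
          f′0 = splice-≤ f g {a} z≤n
          f′n : f′ n′ ≡ f n
          f′n = trans (splice-> f g a<n′) (cong f n′+c)
          fan′ : Fan z n′ f′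
          fan′ = record
            { walk   = splice-walk (λ k<a → walk (<-≤-trans (<-trans k<a a<b) b≤n))
                         (subst (λ m → Adj (f a) (f m)) (sym b≡) e)
                         (λ _ k<n′ → walk (shift k<n′))
            ; first  = subst (Adj z) (sym f′0) first
            ; last   = subst (Adj z) (sym f′n) last
            ; apart  = λ eq → apart (trans (sym f′0) (trans eq f′n))
            ; nonadj = λ e′ → nonadj (subst₂ Adj f′0 f′n e′)
            }
          back : MeetsInterior z n′ f′ → MeetsInterior z n f
          back (k , 0<k , k<n′ , r) with k ≤? a
          ... | yes _ = k , 0<k , <-trans k<n′ n′<n , r
          ... | no  _ = k + c , ≤-trans 0<k (m≤m+n k c) , shift k<n′ , r

        -- The earlier occurrence inherits the edge leaving the later one; if the later one is the
        -- end of the walk, it inherits the edge entering the earlier one. Either edge is a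
        -- shortcut, and `apart` excludes that both occurrences are ends.
        repetition : ∀ {a b} → a < b → b ≤ n → f a ≡ f b → MeetsInterior z n f
        repetition {a} {b} a<b b≤n eq with m≤n⇒m<n∨m≡n b≤n
        ... | inj₁ b<n =
          shortcut (m≤n⇒m≤1+n a<b) b<n (λ q → <⇒≢ a<b (sym (suc-injective q)))
                   (subst (λ v → Adj v (f (suc b))) (sym eq) (walk b<n))
        repetition {zero}  _   _   eq | inj₂ refl = contradiction eq apart
        repetition {suc a} a<b b≤n eq | inj₂ refl =
          shortcut (<⇒≤ a<b) b≤n (λ q → <⇒≢ a<b (sym q))
                   (subst (Adj (f a)) eq (walk (<⇒≤ a<b)))

        shortcut± : ∀ {a b} → a ≤ n → b ≤ n → b ≢ suc a → a ≢ suc b →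
                    Adj (f a) (f b) → MeetsInterior z n f
        shortcut± {a} {b} a≤n b≤n p q e with <-cmp a b
        ... | tri< a<b _ _  = shortcut a<b b≤n p e
        ... | tri≈ _ refl _ = contradiction e (no-loop _)
        ... | tri> _ _ b<a  = shortcut b<a a≤n q (adj-sym e)

        2≤n : 2 ≤ n
        2≤n = go walk apart nonadj
          where
          go : ∀ {n} → IsWalk n f → f 0 ≢ f n → ¬ Adj (f 0) (f n) → 2 ≤ n
          go {0}           _ p _ = contradiction refl p
          go {1}           w _ q = contradiction (w (s≤s z≤n)) q
          go {suc (suc _)} _ _ _ = s≤s (s≤s z≤n)

        interior : ∀ {k} → k ≤ n → k ≢ 0 → k ≢ n → Close z (f k) →
                   MeetsInterior z n f
        interior {k} k≤n k≢0 k≢n r = k , n≢0⇒n>0 k≢0 , ≤∧≢⇒< k≤n k≢n , r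

        -- Without repetitions and without `z` on the walk, `z` and the walk form a cycle on `n + 2`
        -- vertices. A chord at `z` is what is sought; a chord between walk vertices is a shortcut.
        meets : MeetsInterior z n f
        meets with Fin.any? {n = suc n} (λ i → Fin.any? {n = suc n} (λ j →
                     (toℕ i <? toℕ j) ×-dec (f (toℕ i) Fin.≟ f (toℕ j))))
        ... | yes (i , j , i<j , eq) = repetition i<j (s≤s⁻¹ (Fin.toℕ<n j)) eq
        ... | no inj with Fin.any? {n = suc n} (λ i → z Fin.≟ f (toℕ i))
        ...   | yes (i , eq) =
          interior (s≤s⁻¹ (Fin.toℕ<n i))
            (λ q → no-loop z (subst (Adj z) (sym (trans eq (cong f q))) first))
            (λ q → no-loop z (subst (Adj z) (sym (trans eq (cong f q))) last))
            (inj₁ eq)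
        ...   | no z∉ = fromChord (chordal (suc n) (s≤s (s≤s 2≤n)) C)
          where
          vertex : Fin (suc (suc n)) → V
          vertex zero    = z
          vertex (suc k) = f (toℕ k)

          distinct : ∀ {i j} → vertex i ≡ vertex j → i ≡ j
          distinct {zero}  {zero}  _  = refl
          distinct {zero}  {suc j} eq = contradiction (j , eq) z∉
          distinct {suc i} {zero}  eq = contradiction (i , sym eq) z∉
          distinct {suc i} {suc j} eq with <-cmp (toℕ i) (toℕ j)
          ... | tri< i<j _ _ = contradiction (i , j , i<j , eq) inj
          ... | tri≈ _ q _   = cong suc (Fin.toℕ-injective q)
          ... | tri> _ _ j<i = contradiction (j , i , j<i , sym eq) inj

          step : (i : Fin (suc n)) → Adj (vertex (inject₁ i)) (vertex (suc i))
          step zero    = first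
          step (suc i) = subst (λ k → Adj (f k) (f (suc (toℕ i))))
                               (sym (Fin.toℕ-inject₁ i)) (walk (Fin.toℕ<n i))

          C : Cycle G (suc n)
          C = record
            { vertex = vertex ; distinct = distinct ; step = step
            ; close  = adj-sym (subst (λ k → Adj z (f k)) (sym (Fin.toℕ-fromℕ n)) last) }

          spoke : ∀ (k : Fin (suc n)) → ¬ Follows {suc n} zero (suc k) →
                  ¬ Follows (suc k) zero → Adj z (f (toℕ k)) → MeetsInterior z n f
          spoke k p q e = interior (s≤s⁻¹ (Fin.toℕ<n k))
            (λ k≡0 → p (inj₁ (cong suc k≡0)))
            (λ k≡n → q (inj₂ (cong suc (Fin.toℕ-injective
                                (trans k≡n (sym (Fin.toℕ-fromℕ n)))) , refl)))
            (inj₂ e)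

          fromChord : HasChord G C → MeetsInterior z n f
          fromChord (zero  , zero  , _ , _ , e) = contradiction e (no-loop z)
          fromChord (zero  , suc k , p , q , e) = spoke k p q e
          fromChord (suc k , zero  , p , q , e) = spoke k q p (adj-sym e)
          fromChord (suc k , suc l , p , q , e) =
            shortcut± (s≤s⁻¹ (Fin.toℕ<n k)) (s≤s⁻¹ (Fin.toℕ<n l))
              (λ r → p (inj₁ (cong suc r))) (λ r → q (inj₁ (cong suc r))) e

      fan-meets : ∀ {z n f} → Acc _<_ n → Fan z n f → MeetsInterior z n f
      fan-meets (acc rs) fan = meets fan (λ n′<n → fan-meets (rs n′<n))

    -- The form in which chordality is applied from here on.
    chordal-fan : ∀ {z n f} → IsWalk n f → Adj z (f 0) → Adj z (f n) →
                  f 0 ≢ f n → ¬ Adj (f 0) (f n) → MeetsInterior z n f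
    chordal-fan {n = n} w p q r s = fan-meets (<-wellFounded n)
      (record { walk = w ; first = p ; last = q ; apart = r ; nonadj = s })

-- Least witnesses and reversal of paths.

least : {P : ℕ → Set} → (∀ n → Dec (P n)) → ∀ {n} → P n →
        ∃[ m ] P m × (∀ k → P k → m ≤ k)
least P? {zero}  p = 0 , p , λ _ _ → z≤n
least P? {suc n} p with P? 0
... | yes p₀ = 0 , p₀ , λ _ _ → z≤n
... | no ¬p₀ with least (λ k → P? (suc k)) p
...   | m , pm , min = suc m , pm , λ where
  zero    p₀ → contradiction p₀ ¬p₀
  (suc k) pk → s≤s (min k pk)

reverse : ∀ (G : Graph) {u v n} → Path G u v n → Path G v u n
reverse G {n = n} P = record
  { vertex   = λ i → vertex (opposite i)
  ; distinct = λ eq → trans (sym (Fin.opposite-involutive _))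
                        (trans (cong opposite (distinct eq))
                               (Fin.opposite-involutive _))
  ; start    = end
  ; end      = trans (cong vertex opposite-fromℕ) start
  ; step     = λ i → adj-sym
      (subst (λ j → Adj (vertex (inject₁ (opposite i))) (vertex j))
             (sym (opposite-inject₁ i)) (step (opposite i)))
  }
  where
  open Graph G
  open Path P
  opposite-fromℕ : opposite (fromℕ n) ≡ zero
  opposite-fromℕ = Fin.opposite-involutive zero
  opposite-inject₁ : ∀ {n} (i : Fin n) → opposite (inject₁ i) ≡ suc (opposite i)
  opposite-inject₁ zero    = refl
  opposite-inject₁ (suc i) = cong inject₁ (opposite-inject₁ i)

-- Distances and geodesics in a connected graph.

module Distances (G : Graph) (connected : Connected G) where
  open Graph G

  -- Reachability by walks is decidable by recursion on the length, and a shortest walk is as short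
  -- as a shortest path.
  Reach : V → ℕ → V → Set
  Reach s zero    v = s ≡ v
  Reach s (suc n) v = ∃[ u ] Adj u v × Reach s n u

  reach? : ∀ s n v → Dec (Reach s n v)
  reach? s zero    v = s Fin.≟ v
  reach? s (suc n) v = Fin.any? (λ u → adj? u v ×-dec reach? s n u)

  path⇒reach : ∀ {s v n} → Path G s v n → Reach s n v
  path⇒reach {s} {n = n} P =
    subst₂ (Reach s) (Fin.toℕ-fromℕ n) end
      (<-weakInduction (λ i → Reach s (toℕ i) (vertex i)) (sym start)
        (λ i r → vertex (inject₁ i) , step i ,
                 subst (λ k → Reach s k (vertex (inject₁ i)))
                       (Fin.toℕ-inject₁ i) r)
        (fromℕ n))
    where open Path P

  abstract
    private
      shortest : ∀ s v → ∃[ n ] Reach s n v × (∀ k → Reach s k v → n ≤ k)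
      shortest s v =
        least (λ n → reach? s n v) (path⇒reach (proj₂ (connected s v)))

    dist : V → V → ℕ
    dist s v = proj₁ (shortest s v)

    dist-reach : ∀ s v → Reach s (dist s v) v
    dist-reach s v = proj₁ (proj₂ (shortest s v))

    dist-least : ∀ {s v n} → Reach s n v → dist s v ≤ n
    dist-least {s} {v} = proj₂ (proj₂ (shortest s v)) _

  dist-self : ∀ s → dist s s ≡ 0
  dist-self s = n≤0⇒n≡0 (dist-least refl)

  dist≡0 : ∀ {s v} → dist s v ≡ 0 → s ≡ v
  dist≡0 {s} {v} eq = subst (λ n → Reach s n v) eq (dist-reach s v)

  dist-step : ∀ {s u v} → Adj u v → dist s v ≤ suc (dist s u)
  dist-step {s} {u} e = dist-least (u , e , dist-reach s u)

  parent : ∀ {s v k} → dist s v ≡ suc k → ∃[ u ] Adj u v × dist s u ≡ k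
  parent {s} {v} {k} eq with subst (λ n → Reach s n v) eq (dist-reach s v)
  ... | u , e , r = u , e , ≤-antisym (dist-least r)
                      (s≤s⁻¹ (subst (_≤ suc (dist s u)) eq (dist-step e)))

  -- The level condition implies distinctness and fixes the first vertex. The last vertex is not an
  -- index of the type, which makes it easy to replace parts of a geodesic.
  record Geodesic (s : V) (n : ℕ) : Set where
    field
      vertex : ℕ → V
      level  : ∀ {k} → k ≤ n → dist s (vertex k) ≡ k
      walk   : IsWalk G n vertex

    source : vertex 0 ≡ s
    source = sym (dist≡0 (level z≤n))

    path : Path G s (vertex n) n
    path = record
      { vertex   = λ i → vertex (toℕ i)
      ; distinct = λ {i} {j} eq → Fin.toℕ-injective
          (trans (sym (level (s≤s⁻¹ (Fin.toℕ<n i))))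
                 (trans (cong (dist s) eq) (level (s≤s⁻¹ (Fin.toℕ<n j)))))
      ; start    = source
      ; end      = cong vertex (Fin.toℕ-fromℕ n)
      ; step     = λ i → subst (λ k → Adj (vertex k) (vertex (suc (toℕ i))))
                           (sym (Fin.toℕ-inject₁ i)) (walk (Fin.toℕ<n i))
      }

  open Geodesic

  splice-geodesic : ∀ {s i n} (P : Geodesic s i) (g : ℕ → V) →
    Adj (vertex P i) (g (suc i)) →
    (∀ {k} → i < k → k ≤ n → dist s (g k) ≡ k) →
    (∀ {k} → i < k → k < n → Adj (g k) (g (suc k))) → Geodesic s n
  splice-geodesic {s} {i} P g e lev w = record
    { vertex = splice i (vertex P) g
    ; level  = λ {k} k≤n → levels k≤n
    ; walk   = splice-walk G (walk P) e w
    }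
    where
    levels : ∀ {k} → k ≤ _ → dist s (splice i (vertex P) g k) ≡ k
    levels {k} k≤n with k ≤? i
    ... | yes k≤i = level P k≤i
    ... | no  k≰i = lev (≰⇒> k≰i) k≤n

  geodesic : ∀ {s v n} → dist s v ≡ n → ∃[ P ] vertex {s} {n} P n ≡ v
  geodesic {s} {v} {zero} eq =
    record { vertex = λ _ → v ; level = λ { z≤n → eq } ; walk = λ () } , refl
  geodesic {s} {v} {suc n} eq with parent eq
  ... | u , e , lu with geodesic lu
  ...   | P , Pn =
    splice-geodesic P (λ _ → v) (subst (λ w → Adj w v) (sym Pn) e)
      (λ n<k k≤1+n → trans eq (≤-antisym n<k k≤1+n))
      (λ n<k k<1+n → contradiction (s≤s⁻¹ k<1+n) (<⇒≱ n<k))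
    , splice-> (vertex P) (λ _ → v) {n} ≤-refl

  dist-isDistance : ∀ s v → Distance G s v (dist s v)
  dist-isDistance s v with geodesic {s} {v} refl
  ... | P , Pn = subst (λ w → Path G s w _) Pn (path P) ,
                 λ _ Q → dist-least (path⇒reach Q)

  dist-unique : ∀ {s v n} → Distance G s v n → dist s v ≡ n
  dist-unique {s} {v} (P , min) =
    ≤-antisym (dist-least (path⇒reach P)) (min _ (proj₁ (dist-isDistance s v)))

  dist-sym : ∀ u v → dist u v ≡ dist v u
  dist-sym u v = ≤-antisym (half u v) (half v u)
    where
    half : ∀ u v → dist u v ≤ dist v u
    half u v =
      dist-least (path⇒reach (reverse G (proj₁ (dist-isDistance v u))))

  walk-dist : ∀ {s n f} → IsWalk G n f → ∀ k j → k + j ≤ n →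
              dist s (f (k + j)) ≤ j + dist s (f k)
  walk-dist {s} {f = f} w k zero    _ =
    ≤-reflexive (cong (λ m → dist s (f m)) (+-identityʳ k))
  walk-dist {s} {n} {f} w k (suc j) k+j<n =
    subst (λ m → dist s (f m) ≤ suc (j + dist s (f k))) (sym (+-suc k j))
      (≤-trans (dist-step (w k+j<n′))
               (s≤s (walk-dist w k j (<⇒≤ k+j<n′))))
    where
    k+j<n′ : k + j < n
    k+j<n′ = subst (_≤ n) (+-suc k j) k+j<n

  -- Position `k` has distance at most `k` from the start, and at least `k` because the remaining
  -- `n ∸ k` edges must still reach distance `n`.
  path⇒geodesic : ∀ {s v n} (P : Path G s v n) → dist s v ≡ n →
    ∃[ Q ] (∀ i → vertex {s} {n} Q (toℕ i) ≡ Path.vertex P i)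
  path⇒geodesic {s} {v} {n} P eq = record
    { vertex = p
    ; level  = λ k≤n → ≤-antisym (upper k≤n) (lower k≤n)
    ; walk   = w
    } , λ i → at refl
    where
    p : ℕ → V
    -- Capping the index at `n` extends the path to a sequence on `ℕ`.
    p k = Path.vertex P (fromℕ< (s≤s (m⊓n≤n k n)))
    at : ∀ {k i} → toℕ i ≡ k → p k ≡ Path.vertex P i
    at {k} {i} refl = cong (Path.vertex P) (Fin.toℕ-injective
      (trans (Fin.toℕ-fromℕ< _) (m≤n⇒m⊓n≡m (s≤s⁻¹ (Fin.toℕ<n i)))))
    w : IsWalk G n p
    w k<n = subst₂ Adj
      (sym (at (trans (Fin.toℕ-inject₁ _) (Fin.toℕ-fromℕ< k<n))))
      (sym (at (cong suc (Fin.toℕ-fromℕ< k<n))))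
      (Path.step P (fromℕ< k<n))
    p0 : dist s (p 0) ≡ 0
    p0 = trans (cong (dist s) (trans (at refl) (Path.start P))) (dist-self s)
    pn : dist s (p n) ≡ n
    pn = trans (cong (dist s) (trans (at (Fin.toℕ-fromℕ n)) (Path.end P))) eq
    upper : ∀ {k} → k ≤ n → dist s (p k) ≤ k
    upper {k} k≤n = subst (dist s (p k) ≤_)
      (trans (cong (k +_) p0) (+-identityʳ k)) (walk-dist w 0 k k≤n)
    lower : ∀ {k} → k ≤ n → k ≤ dist s (p k)
    lower {k} k≤n = +-cancelˡ-≤ (n ∸ k) k (dist s (p k))
      (subst (_≤ n ∸ k + dist s (p k))
        (trans (cong (λ m → dist s (p m)) (m+[n∸m]≡n k≤n))
               (trans pn (sym (m∸n+n≡m k≤n))))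
        (walk-dist w k (n ∸ k) (≤-reflexive (m+[n∸m]≡n k≤n))))

-- Distance layers of a chordal graph.

module Layers (G : Graph) (connected : Connected G) (chordal : Chordal G) where
  open Graph G
  open Distances G connected public
  open Geodesic

  level-gap : ∀ {s u v i j} → dist s u ≡ i → dist s v ≡ j → suc i < j →
              ¬ Close G u v
  level-gap {s} {u} {v} refl refl gap (inj₁ refl) = 1+n≰n (<⇒≤ gap)
  level-gap {s} {u} {v} refl refl gap (inj₂ e)    = <⇒≱ gap (dist-step e)

  level-≢ : ∀ {s u v i j} → dist s u ≡ i → dist s v ≡ j → i ≢ j → u ≢ v
  level-≢ refl refl i≢j refl = i≢j refl

  neighbour-level : ∀ {s u v k} → Adj u v → dist s u ≡ k →
    dist s v ≡ suc k ⊎ dist s v ≡ k ⊎ suc (dist s v) ≡ k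
  neighbour-level {s} {u} {v} e refl with <-cmp (dist s u) (dist s v)
  ... | tri< u<v _ _ = inj₁ (≤-antisym (dist-step e) u<v)
  ... | tri≈ _ eq _  = inj₂ (inj₁ (sym eq))
  ... | tri> _ _ v<u = inj₂ (inj₂ (≤-antisym v<u (dist-step (adj-sym e))))

  -- The parents of the two ends are close by induction, and a parent sees
  -- nothing of the walk except possibly its ends, so chordality closes the
  -- walk up.
  joined-above : ∀ i {s n f} → IsWalk G n f →
    dist s (f 0) ≡ i → dist s (f n) ≡ i →
    (∀ {k} → 0 < k → k < n → i < dist s (f k)) → Close G (f 0) (f n)
  joined-above zero _ p q _ = inj₁ (trans (sym (dist≡0 p)) (dist≡0 q))
  joined-above (suc i) {s} {n} {f} w p q above with close? G (f 0) (f n)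
  ... | yes c = c
  ... | no ¬c with parent p | parent q
  ...   | a , a~ , la | b , b~ , lb =
    ⊥-elim (conclude (joined-above i walk⁺ la lh above⁺))
    where
    -- `f⁺` is the walk `f` followed by `b`, and `h` is `f⁺` preceded by `a`.
    f⁺ h : ℕ → V
    f⁺ = splice n f (λ _ → b)
    h zero    = a
    h (suc k) = f⁺ k

    f⁺0 : f⁺ 0 ≡ f 0
    f⁺0 = splice-≤ f (λ _ → b) {n} z≤n
    f⁺n : f⁺ n ≡ f n
    f⁺n = splice-≤ f (λ _ → b) {n} ≤-refl
    f⁺1+n : f⁺ (suc n) ≡ b
    f⁺1+n = splice-> f (λ _ → b) {n} ≤-refl

    walk-f⁺ : IsWalk G (suc n) f⁺
    walk-f⁺ = splice-walk G {g = λ _ → b} w (adj-sym b~)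
                (λ n<k k<1+n → contradiction (s≤s⁻¹ k<1+n) (<⇒≱ n<k))

    walk⁺ : IsWalk G (suc (suc n)) h
    walk⁺ {zero}  _         = subst (Adj a) (sym f⁺0) a~
    walk⁺ {suc k} (s≤s k<n) = walk-f⁺ k<n

    lh : dist s (h (suc (suc n))) ≡ i
    lh = trans (cong (dist s) f⁺1+n) lb

    above-f : ∀ {k} → k ≤ n → i < dist s (f k)
    above-f {zero}  _   = ≤-reflexive (sym p)
    above-f {suc k} k<n with m≤n⇒m<n∨m≡n k<n
    ... | inj₁ 1+k<n = <⇒≤ (above (s≤s z≤n) 1+k<n)
    ... | inj₂ refl  = ≤-reflexive (sym q)

    above⁺ : ∀ {k} → 0 < k → k < suc (suc n) → i < dist s (h k)
    above⁺ {suc k} _ (s≤s (s≤s k≤n)) =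
      subst (λ v → i < dist s v) (sym (splice-≤ f (λ _ → b) {n} k≤n)) (above-f k≤n)

    hidden : ∀ {z k} → dist s z ≡ i → 0 < k → k < n → ¬ Close G z (f k)
    hidden lz 0<k k<n = level-gap lz refl (above 0<k k<n)

    noCommon : ∀ {z} → dist s z ≡ i → Adj z (f 0) → Adj z (f n) → ⊥
    noCommon lz e e′
      with chordal-fan G chordal w e e′ (λ eq → ¬c (inj₁ eq)) (λ r → ¬c (inj₂ r))
    ... | k , 0<k , k<n , r = hidden lz 0<k k<n r

    conclude : ¬ Close G a (f⁺ (suc n))
    conclude cl with subst (Close G a) f⁺1+n cl
    ... | inj₁ refl = noCommon la a~ b~
    ... | inj₂ a~b with adj? b (f 0)
    ...   | yes b~f0 = noCommon lb b~f0 b~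
    ...   | no  b≁f0
      -- Inside `f` followed by `b`, the only vertex that `a` can see is `f n`; that makes `a` a
      -- parent of both ends.
      with chordal-fan G chordal {n = suc n} walk-f⁺
             (subst (Adj a) (sym f⁺0) a~) (subst (Adj a) (sym f⁺1+n) a~b)
             (λ eq → level-≢ p lb 1+n≢n (trans (sym f⁺0) (trans eq f⁺1+n)))
             (λ e → b≁f0 (adj-sym (subst₂ Adj f⁺0 f⁺1+n e)))
    ... | k , 0<k , k<1+n , r
      with subst (Close G a) (splice-≤ f (λ _ → b) (s≤s⁻¹ k<1+n)) r
    ... | r′ with m≤n⇒m<n∨m≡n (s≤s⁻¹ k<1+n)
    ...   | inj₁ k<n  = hidden la 0<k k<n r′
    conclude cl | inj₂ a~b | no _ | k , _ , _ , _ | inj₁ eq | inj₂ refl =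
      level-≢ la q (λ eq → 1+n≢n (sym eq)) eq
    conclude cl | inj₂ a~b | no _ | k , _ , _ , _ | inj₂ e | inj₂ refl =
      noCommon la a~ e

  private
    walk₂ : V → V → V → ℕ → V
    walk₂ a b c 0 = a
    walk₂ a b c 1 = b
    walk₂ a b c _ = c

    walk₃ : V → V → V → V → ℕ → V
    walk₃ a b c d zero    = a
    walk₃ a b c d (suc k) = walk₂ b c d k

    isWalk₂ : ∀ {a b c} → Adj a b → Adj b c → IsWalk G 2 (walk₂ a b c)
    isWalk₂ p q {0} _ = p
    isWalk₂ p q {1} _ = q
    isWalk₂ p q {suc (suc _)} (s≤s (s≤s ()))

    isWalk₃ : ∀ {a b c d} → Adj a b → Adj b c → Adj c d →
              IsWalk G 3 (walk₃ a b c d)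
    isWalk₃ p q r {zero}  _         = p
    isWalk₃ p q r {suc k} (s≤s k<2) = isWalk₂ q r k<2

  joined-above₂ : ∀ {s i a y b} → dist s a ≡ i → dist s b ≡ i →
    dist s y ≡ suc i → Adj a y → Adj y b → Close G a b
  joined-above₂ {s} {i} {a} {y} {b} la lb ly p q =
    joined-above i {f = walk₂ a y b} (isWalk₂ p q) la lb above
    where
    above : ∀ {k} → 0 < k → k < 2 → i < dist s (walk₂ a y b k)
    above {1} _ _ = ≤-reflexive (sym ly)
    above {suc (suc _)} _ (s≤s (s≤s ()))

  joined-above₃ : ∀ {s i a y z b} → dist s a ≡ i → dist s b ≡ i →
    dist s y ≡ suc i → dist s z ≡ suc i →
    Adj a y → Adj y z → Adj z b → Close G a b
  joined-above₃ {s} {i} {a} {y} {z} {b} la lb ly lz p q r =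
    joined-above i {f = walk₃ a y z b} (isWalk₃ p q r) la lb above
    where
    above : ∀ {k} → 0 < k → k < 3 → i < dist s (walk₃ a y z b k)
    above {1} _ _ = ≤-reflexive (sym ly)
    above {2} _ _ = ≤-reflexive (sym lz)
    above {suc (suc (suc _))} _ (s≤s (s≤s (s≤s ())))

  four-cycle : ∀ {a b c d} → Adj a b → Adj b c → Adj c d → Adj d a →
               b ≢ d → Close G a c ⊎ Adj b d
  four-cycle {a} {b} {c} {d} ab bc cd da b≢d with adj? b d
  ... | yes bd = inj₂ bd
  ... | no ¬bd
    with chordal-fan G chordal {f = walk₂ b c d} (isWalk₂ bc cd)
           ab (adj-sym da) b≢d ¬bd
  ... | 1 , _ , _ , r = inj₁ r
  ... | suc (suc _) , _ , s≤s (s≤s ()) , _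

  -- Parents `a` of `u` and `b` of `w` are equal or adjacent. If they are adjacent, a diagonal of
  -- the four-cycle `a`, `u`, `w`, `b` makes one of them a common parent.
  common-parent : ∀ {s i u w} → Adj u w → dist s u ≡ suc i → dist s w ≡ suc i →
                  ∃[ p ] Adj p u × Adj p w × dist s p ≡ i
  common-parent e lu lw with parent lu | parent lw
  ... | a , a~u , la | b , b~w , lb
    with joined-above₃ la lb lu lw a~u e (adj-sym b~w)
  ... | inj₁ refl = a , a~u , b~w , la
  ... | inj₂ a~b
    with four-cycle a~u e (adj-sym b~w) (adj-sym a~b) (level-≢ lu lb 1+n≢n)
  ... | inj₁ (inj₁ refl) = contradiction (trans (sym lw) la) 1+n≢n
  ... | inj₁ (inj₂ a~w)  = a , a~u , a~w , la
  ... | inj₂ u~b         = b , adj-sym u~b , b~w , lb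

-- Induced subgraphs from lists of edges and non-edges.

Covers : ∀ {n} → List (Fin n × Fin n) → List (Fin n × Fin n) → Set
Covers es ns = ∀ i j →
  i ≡ j ⊎ ((i , j) ∈ es ⊎ (j , i) ∈ es) ⊎ ((i , j) ∈ ns ⊎ (j , i) ∈ ns)

covers? : ∀ {n} (es ns : List (Fin n × Fin n)) → Dec (Covers es ns)
covers? {n} es ns = Fin.all? λ i → Fin.all? λ j →
  (i Fin.≟ j) ⊎-dec ((((i , j) ∈? es) ⊎-dec ((j , i) ∈? es)) ⊎-dec
                     (((i , j) ∈? ns) ⊎-dec ((j , i) ∈? ns)))
  where open DecMembership (≡-dec (Fin._≟_ {n}) (Fin._≟_ {n})) using (_∈?_)

module _ (G : Graph) {n : ℕ} (es ns : List (Fin n × Fin n))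
         (loopless : All (uncurry _≢_) es) (covers : Covers es ns)
         (vs : Vec (Graph.V G) n) where
  open Graph G

  -- Every pair of distinct indices is listed as an edge or a non-edge. Injectivity follows, since
  -- equal vertices are neither adjacent nor apart in the sense of `Close`.
  induced : All (uncurry λ i j → Adj (lookup vs i) (lookup vs j)) es →
            All (uncurry λ i j → ¬ Close G (lookup vs i) (lookup vs j)) ns →
            ContainsInduced G (fromEdges n es loopless)
  induced edges nonedges = f , injective , λ i j → mk⇔ to (from i j)
    where
    f : Fin n → V
    f = lookup vs
    to : ∀ {i j} → (i , j) ∈ es ⊎ (j , i) ∈ es → Adj (f i) (f j)
    to (inj₁ ∈es) = All.lookup edges ∈es
    to (inj₂ ∈es) = adj-sym (All.lookup edges ∈es)
    apart : ∀ {i j} → (i , j) ∈ ns ⊎ (j , i) ∈ ns → ¬ Close G (f i) (f j)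
    apart (inj₁ ∈ns) = All.lookup nonedges ∈ns
    apart (inj₂ ∈ns) c = All.lookup nonedges ∈ns (close-sym G c)
    injective : ∀ {i j} → f i ≡ f j → i ≡ j
    injective {i} {j} eq with covers i j
    ... | inj₁ i≡j        = i≡j
    ... | inj₂ (inj₁ e)   =
      contradiction (subst (Adj (f i)) (sym eq) (to e)) (no-loop (f i))
    ... | inj₂ (inj₂ non) = contradiction (inj₁ eq) (apart non)
    from : ∀ i j → Adj (f i) (f j) → (i , j) ∈ es ⊎ (j , i) ∈ es
    from i j e with covers i j
    ... | inj₁ refl       = contradiction e (no-loop (f i))
    ... | inj₂ (inj₁ e′)  = e′
    ... | inj₂ (inj₂ non) = contradiction (inj₂ e) (apart non)

clawNonEdges : List (Fin 4 × Fin 4)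
clawNonEdges = (# 1 , # 2) ∷ (# 1 , # 3) ∷ (# 2 , # 3) ∷ []

netNonEdges : List (Fin 6 × Fin 6)
netNonEdges =
  (# 3 , # 1) ∷ (# 3 , # 2) ∷ (# 3 , # 4) ∷ (# 3 , # 5) ∷ (# 4 , # 0) ∷
  (# 4 , # 2) ∷ (# 4 , # 5) ∷ (# 5 , # 0) ∷ (# 5 , # 1) ∷ []

tentNonEdges : List (Fin 6 × Fin 6)
tentNonEdges =
  (# 0 , # 4) ∷ (# 0 , # 3) ∷ (# 0 , # 5) ∷
  (# 3 , # 1) ∷ (# 3 , # 5) ∷ (# 5 , # 2) ∷ []

claw-covers : Covers clawEdges clawNonEdges
claw-covers = from-yes (covers? clawEdges clawNonEdges)

net-covers : Covers netEdges netNonEdges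
net-covers = from-yes (covers? netEdges netNonEdges)

tent-covers : Covers tentEdges tentNonEdges
tent-covers = from-yes (covers? tentEdges tentNonEdges)

-- Levels that differ by at most one.

Near : ℕ → ℕ → Set
Near m n = m ≤ suc n × n ≤ suc m

beside : ∀ {m n} → Near m n → n ≢ m → n ≡ suc m ⊎ suc n ≡ m
beside {m} {n} (p , q) n≢m with <-cmp m n
... | tri< m<n _ _ = inj₁ (≤-antisym q m<n)
... | tri≈ _ eq _  = contradiction (sym eq) n≢m
... | tri> _ _ n<m = inj₂ (≤-antisym n<m p)

-- Only the level just above `m` and the one just below are available, so two of the three coincide.
two-beside : ∀ {m x y z} → Near m x → Near m y → Near m z →
             x ≢ m → y ≢ m → z ≢ m → x ≢ y → x ≢ z → y ≢ z → ⊥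
two-beside nx ny nz x≢m y≢m z≢m x≢y x≢z y≢z
  with beside nx x≢m | beside ny y≢m | beside nz z≢m
... | inj₁ x   | inj₁ y   | _        = x≢y (trans x (sym y))
... | inj₁ x   | inj₂ _   | inj₁ z   = x≢z (trans x (sym z))
... | inj₁ _   | inj₂ y   | inj₂ z   = y≢z (suc-injective (trans y (sym z)))
... | inj₂ x   | inj₂ y   | _        = x≢y (suc-injective (trans x (sym y)))
... | inj₂ x   | inj₁ _   | inj₂ z   = x≢z (suc-injective (trans x (sym z)))
... | inj₂ _   | inj₁ y   | inj₁ z   = y≢z (trans y (sym z))

-- On opposite sides of `m`, the numbers `n` and `x` would differ by two.
near-both : ∀ {m n x} → Near m n → Near m x → Near n x → n ≢ m → x ≢ m → x ≡ n
near-both mn mx nx n≢m x≢m with beside mn n≢m | beside mx x≢m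
... | inj₁ n    | inj₁ x    = trans x (sym n)
... | inj₂ n    | inj₂ x    = suc-injective (trans x (sym n))
... | inj₁ refl | inj₂ refl = contradiction (proj₁ nx) 1+n≰n
... | inj₂ refl | inj₁ refl = contradiction (proj₂ nx) 1+n≰n

-- Claw-freeness and domination by a geodesic.

module _ (G : Graph) (connected : Connected G) (chordal : Chordal G)
         (clawFree : ClawFree G) where
  open Graph G
  open Layers G connected chordal
  open Geodesic

  no-claw : ∀ {o p q r} → Adj o p → Adj o q → Adj o r →
            ¬ Close G p r → ¬ Close G q r → Close G p q
  no-claw {o} {p} {q} {r} op oq or ¬pr ¬qr with close? G p q
  ... | yes c  = c
  ... | no ¬pq = ⊥-elim (clawFree
    (induced G clawEdges clawNonEdges (from-yes (loopless? clawEdges)) claw-covers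
      (o ∷ p ∷ q ∷ r ∷ [])
      (op ∷ oq ∷ or ∷ []) (¬pq ∷ ¬pr ∷ ¬qr ∷ [])))

  Dominated : ∀ {s n} → Geodesic s n → V → Set
  Dominated {n = n} P x = ∃[ k ] k < suc n × Close G x (vertex P k)

  dominated? : ∀ {s n} (P : Geodesic s n) x → Dec (Dominated P x)
  dominated? {n = n} P x = anyUpTo? (λ k → close? G x (vertex P k)) (suc n)

  -- At distance 0 or 1 from `s`, the first vertex of `P` would dominate `x`.
  2≤dist : ∀ {s n} (P : Geodesic s n) {x} → ¬ Dominated P x → 2 ≤ dist s x
  2≤dist {s} P {x} far with dist s x in eq
  ... | 0 = contradiction
    (0 , s≤s z≤n , inj₁ (trans (sym (dist≡0 eq)) (sym (source P)))) far
  ... | 1 with u , u~x , lu ← parent eq = contradiction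
    (0 , s≤s z≤n , inj₂ (subst (Adj x) (trans (sym (dist≡0 lu)) (sym (source P)))
                               (adj-sym u~x))) far
  ... | suc (suc _) = s≤s (s≤s z≤n)

  -- Net-free and tent-free graphs are narrow.

  module _ (netFree : NetFree G) (tentFree : TentFree G) where

    -- Parents are followed from `x` towards `s`; the first dominated one is `y`. The descent stops
    -- before `s`, which lies on `P`.
    frontier : ∀ {s n} (P : Geodesic s n) k {x} → dist s x ≡ k →
      ¬ Dominated P x →
      ∃[ x′ ] ∃[ y ] ¬ Dominated P x′ × Dominated P y × Adj y x′
    frontier P zero lx far =
      contradiction (2≤dist P far) λ 2≤ → <⇒≱ (s≤s z≤n) (subst (2 ≤_) lx 2≤)
    frontier P (suc k) {x} lx far with u , u~x , lu ← parent lx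
      with dominated? P u
    ... | yes dom = x , u , far , dom , u~x
    ... | no ¬dom = frontier P k lu ¬dom

    -- The triangle `p₁`, `p₂`, `y` with pendants `p₀`, `p₃`, `x` is a net. If `y` saw `p₀` or `p₃`,
    -- it would be the centre of a claw with `x` and two vertices of `P` that lie two layers apart.
    inner-case : ∀ {s n b x y} (P : Geodesic s n) → 3 + b ≤ n →
      ¬ Dominated P x → Adj y x →
      Adj y (vertex P (1 + b)) → Adj y (vertex P (2 + b)) → ⊥
    inner-case {s} {n} {b} {x} {y} P b+3≤n far y~x y~p₁ y~p₂ = netFree
      (induced G netEdges netNonEdges (from-yes (loopless? netEdges)) net-covers
        (p₁ ∷ p₂ ∷ y ∷ p₀ ∷ p₃ ∷ x ∷ [])
        (walk P (<⇒≤ b+3≤n) ∷ adj-sym y~p₂ ∷ adj-sym y~p₁ ∷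
         adj-sym (walk P (<⇒≤ (<⇒≤ b+3≤n))) ∷ walk P b+3≤n ∷ y~x ∷ [])
        (gap ≤-refl (<⇒≤ b+3≤n) ∷ (λ c → ¬y₀ (close-sym G c)) ∷
         gap (n≤1+n _) b+3≤n ∷ apart (<⇒≤ (<⇒≤ (<⇒≤ b+3≤n))) ∷
         (λ c → gap ≤-refl b+3≤n (close-sym G c)) ∷
         (λ c → ¬y₃ (close-sym G c)) ∷ apart b+3≤n ∷
         (λ c → apart (<⇒≤ (<⇒≤ b+3≤n)) (close-sym G c)) ∷
         (λ c → apart (<⇒≤ b+3≤n) (close-sym G c)) ∷ []))
      where
      p₀ p₁ p₂ p₃ : V
      p₀ = vertex P b
      p₁ = vertex P (1 + b)
      p₂ = vertex P (2 + b)
      p₃ = vertex P (3 + b)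
      gap : ∀ {i j} → suc i < j → j ≤ n → ¬ Close G (vertex P i) (vertex P j)
      gap i<j j≤n =
        level-gap (level P (≤-trans (<⇒≤ (<⇒≤ i<j)) j≤n)) (level P j≤n) i<j
      apart : ∀ {k} → k ≤ n → ¬ Close G (vertex P k) x
      apart k≤n c = far (_ , s≤s k≤n , close-sym G c)
      adjacent : ∀ {k} → k ≤ n → Close G y (vertex P k) → Adj y (vertex P k)
      adjacent k≤n (inj₁ refl) = ⊥-elim (apart k≤n (inj₂ y~x))
      adjacent k≤n (inj₂ e)    = e
      ¬y₀ : ¬ Close G y p₀
      ¬y₀ c = gap ≤-refl b+2≤n
        (no-claw (adjacent b≤n c) y~p₂ y~x (apart b≤n) (apart b+2≤n))
        where
        b+2≤n = <⇒≤ b+3≤n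
        b≤n = <⇒≤ (<⇒≤ b+2≤n)
      ¬y₃ : ¬ Close G y p₃
      ¬y₃ c = gap ≤-refl b+3≤n
        (no-claw y~p₁ (adjacent b+3≤n c) y~x
                 (apart (<⇒≤ (<⇒≤ b+3≤n))) (apart b+3≤n))

    -- Here `y` sees the last vertex `p₂` of `P`, and by `ecc` no layer lies above that of `p₂`. The
    -- cases are the possible layers of `y` and `x`.
    module _ {s m x y} (P : Geodesic s (2 + m)) (ecc : ∀ v → dist s v ≤ 2 + m)
             (far : ¬ Dominated P x) (y~x : Adj y x)
             (y~p₂ : Adj y (vertex P (2 + m))) where

      private
        p₀ p₁ p₂ : V
        p₀ = vertex P m
        p₁ = vertex P (1 + m)
        p₂ = vertex P (2 + m)
        l₀ : dist s p₀ ≡ m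
        l₀ = level P (m≤n+m m 2)
        l₁ : dist s p₁ ≡ 1 + m
        l₁ = level P (n≤1+n _)
        l₂ : dist s p₂ ≡ 2 + m
        l₂ = level P ≤-refl
        apart₀ : ¬ Close G x p₀
        apart₀ c = far (_ , s≤s (m≤n+m m 2) , c)
        apart₁ : ¬ Close G x p₁
        apart₁ c = far (_ , s≤s (n≤1+n _) , c)
        apart₂ : ¬ Close G x p₂
        apart₂ c = far (_ , ≤-refl , c)
        p₁~p₂ : Adj p₁ p₂
        p₁~p₂ = walk P ≤-refl
        p₀~p₁ : Adj p₀ p₁
        p₀~p₁ = walk P (n≤1+n _)
        below-top : ∀ {u v} → dist s u ≡ m → dist s v ≡ 2 + m → ¬ Close G u v
        below-top lu lv = level-gap lu lv ≤-refl

        -- A parent `r` of `c` would complete a claw at `c` with `x` and `p₂`.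
        no-common-parent : ∀ {c} → dist s x ≡ 2 + m → dist s c ≡ 1 + m →
                           Adj c x → Adj c p₂ → ⊥
        no-common-parent lx lc c~x c~p₂ with r , r~c , lr ← parent lc =
          apart₂ (no-claw c~x c~p₂ (adj-sym r~c)
            (λ c → below-top lr lx (close-sym G c))
            (λ c → below-top lr l₂ (close-sym G c)))

        -- Let `p` be a common parent of `y`, `p₂` and `q` one of `y`, `x`. Unless one of them is a
        -- common parent of `x` and `p₂`, they are adjacent, and a common parent `r` of theirs
        -- completes a tent with central triangle `p`, `q`, `y`.
        both-top : dist s y ≡ 2 + m → dist s x ≡ 2 + m → ⊥
        both-top ly lx
          with p , p~y , p~p₂ , lp ← common-parent y~p₂ ly l₂
          with q , q~y , q~x , lq ← common-parent y~x ly lx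
          with adj? p x | adj? q p₂
        ... | yes p~x | _        = no-common-parent lx lp p~x p~p₂
        ... | no _    | yes q~p₂ = no-common-parent lx lq q~x q~p₂
        ... | no p≁x  | no q≁p₂
          with joined-above₂ lp lq ly p~y (adj-sym q~y)
        ...   | inj₁ refl = p≁x q~x
        ...   | inj₂ p~q with r , r~p , r~q , lr ← common-parent p~q lp lq =
          tentFree (induced G tentEdges tentNonEdges
            (from-yes (loopless? tentEdges)) tent-covers
            (r ∷ p ∷ q ∷ x ∷ y ∷ p₂ ∷ [])
            (p~q ∷ q~y ∷ p~y ∷ r~p ∷ r~q ∷ q~x ∷ adj-sym y~x ∷ p~p₂ ∷ y~p₂ ∷ [])
            (below-top lr ly ∷ below-top lr lx ∷ below-top lr l₂ ∷
             (λ { (inj₁ eq) → level-≢ lx lp 1+n≢n eq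
                ; (inj₂ e)  → p≁x (adj-sym e) }) ∷
             apart₂ ∷
             (λ { (inj₁ eq) → level-≢ l₂ lq 1+n≢n eq
                ; (inj₂ e)  → q≁p₂ (adj-sym e) }) ∷ []))

        -- Let `r` be a common parent of `y` and `p₁`. Claw-freeness at `y` gives an edge from `x`
        -- to `r`, and then claw-freeness at `r` makes `x` close to `p₁`.
        both-below : dist s y ≡ 1 + m → dist s x ≡ 1 + m → Adj y p₁ → ⊥
        both-below ly lx y~p₁
          with r , r~y , r~p₁ , lr ← common-parent y~p₁ ly l₁
          with no-claw y~x (adj-sym r~y) y~p₂ apart₂ (below-top lr l₂)
        ... | inj₁ x≡r = level-≢ lx lr 1+n≢n x≡r
        ... | inj₂ x~r = go lr l₀
          where
          -- On level 0 the vertex `r` has no parent to serve as third leaf, but there `r` and `p₀`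
          -- are both `s`.
          go : ∀ {k} → dist s r ≡ k → dist s p₀ ≡ k → ⊥
          go {zero} lr l₀ =
            apart₀ (inj₂ (subst (Adj x) (trans (sym (dist≡0 lr)) (dist≡0 l₀)) x~r))
          go {suc k} lr′ _ with r′ , r′~r , lr″ ← parent lr′ =
            apart₁ (no-claw (adj-sym x~r) r~p₁ (adj-sym r′~r)
              (gap lx) (gap l₁))
            where
            gap : ∀ {v} → dist s v ≡ 1 + m → ¬ Close G v r′
            gap lv c = level-gap lr″
              (trans lv (cong suc (trans (sym lr) lr′))) ≤-refl (close-sym G c)

      end-case : ⊥
      end-case with neighbour-level (adj-sym y~p₂) l₂
      ... | inj₁ ly = 1+n≰n (subst (_≤ 2 + m) ly (ecc y))
      ... | inj₂ (inj₁ ly) with neighbour-level y~x ly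
      ...   | inj₁ lx = 1+n≰n (subst (_≤ 2 + m) lx (ecc x))
      ...   | inj₂ (inj₁ lx) = both-top ly lx
      ...   | inj₂ (inj₂ lx) = apart₁
        (joined-above₃ (suc-injective lx) l₁ ly l₂ (adj-sym y~x) y~p₂ (adj-sym p₁~p₂))
      end-case | inj₂ (inj₂ 1+ly) with ly ← suc-injective 1+ly
        -- Both `y` and `p₁` are parents of `p₂`.
        with joined-above₂ ly l₁ l₂ y~p₂ (adj-sym p₁~p₂)
      ... | inj₁ y≡p₁ = apart₁ (inj₂ (subst (Adj x) y≡p₁ (adj-sym y~x)))
      ... | inj₂ y~p₁ with neighbour-level y~x ly
      ...   | inj₁ lx with r , r~y , lr ← parent ly = apart₂
        (no-claw y~x y~p₂ (adj-sym r~y)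
          (λ c → below-top lr lx (close-sym G c))
          (λ c → below-top lr l₂ (close-sym G c)))
      ...   | inj₂ (inj₁ lx) = both-below ly lx y~p₁
      ...   | inj₂ (inj₂ lx) = apart₀
        (joined-above₃ (suc-injective lx) l₀ ly l₁ (adj-sym y~x) y~p₁ (adj-sym p₀~p₁))

    -- Stated for a `Path`, so that it serves a path and its reversal and hence covers both ends.
    end-case-path : ∀ {v w D x y} (P : Path G v w D) → dist v w ≡ D →
      (∀ u → dist v u ≤ D) → (∀ i → ¬ Close G x (Path.vertex P i)) →
      Adj y x → Adj y w → ⊥
    end-case-path {v} {w} {D} {x} {y} P lw ecc far y~x y~w
      with Q , Q≡ ← path⇒geodesic P lw =
      go D Q ecc far′ (subst (Adj y) (sym Qend) y~w)
      where
      Qend : vertex Q D ≡ w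
      Qend = trans (cong (vertex Q) (sym (Fin.toℕ-fromℕ D)))
                   (trans (Q≡ (fromℕ D)) (Path.end P))
      far′ : ¬ Dominated Q x
      far′ (k , k<1+D , c) = far (fromℕ< k<1+D)
        (subst (Close G x)
          (trans (cong (vertex Q) (sym (Fin.toℕ-fromℕ< k<1+D))) (Q≡ _)) c)
      go : ∀ D (Q : Geodesic v D) → (∀ u → dist v u ≤ D) → ¬ Dominated Q x →
           Adj y (vertex Q D) → ⊥
      -- Lengths 0 and 1 leave no room for `x`, which has distance at least 2 from `v`.
      go 0 Q ecc far _ = <⇒≱ (s≤s z≤n) (≤-trans (2≤dist Q far) (ecc x))
      go 1 Q ecc far _ = 1+n≰n (≤-trans (2≤dist Q far) (ecc x))
      go (suc (suc m)) Q ecc far e = end-case Q ecc far y~x e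

    netFree×tentFree⇒narrow : Narrow G
    netFree×tentFree⇒narrow x {v} {w} {D} P ((_ , min) , _ , diam) = decide
      where
      lw : dist v w ≡ D
      lw = dist-unique (P , min)
      bound : ∀ a b → dist a b ≤ D
      bound a b = diam a b _ (dist-isDistance a b)
      Q : Geodesic v D
      Q = proj₁ (path⇒geodesic P lw)
      Q≡ : ∀ i → vertex Q (toℕ i) ≡ Path.vertex P i
      Q≡ = proj₂ (path⇒geodesic P lw)
      Q≡ₖ : ∀ {k} (k<1+D : k < suc D) → vertex Q k ≡ Path.vertex P (fromℕ< k<1+D)
      Q≡ₖ k< = trans (cong (vertex Q) (sym (Fin.toℕ-fromℕ< k<))) (Q≡ _)
      target : vertex Q D ≡ w
      target = trans (cong (vertex Q) (sym (Fin.toℕ-fromℕ D)))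
                     (trans (Q≡ (fromℕ D)) (Path.end P))

      module _ {x y} (far : ¬ Dominated Q x) (y~x : Adj y x) where

        farP : ∀ i → ¬ Close G x (Path.vertex P i)
        farP i c = far (toℕ i , Fin.toℕ<n i , subst (Close G x) (sym (Q≡ i)) c)

        at-end : ¬ Adj y (vertex Q D)
        at-end e = end-case-path P lw (bound v) farP y~x (subst (Adj y) target e)

        at-start : ¬ Adj y (vertex Q 0)
        at-start e = end-case-path (reverse G P) (trans (dist-sym w v) lw)
          (bound w) (λ i → farP (opposite i)) y~x (subst (Adj y) (source Q) e)

        at-edge : ∀ {a} → a < D → Adj y (vertex Q a) →
                  ¬ Adj y (vertex Q (suc a))
        at-edge {zero}  _   e _ = at-start e
        at-edge {suc b} a<D e e′ with m≤n⇒m<n∨m≡n a<D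
        ... | inj₁ lt   = inner-case Q lt far y~x e e′
        ... | inj₂ refl = at-end e′

        adjacent : ∀ {k} → k ≤ D → Close G y (vertex Q k) → Adj y (vertex Q k)
        adjacent k≤D (inj₁ eq) = contradiction
          (_ , s≤s k≤D , inj₂ (subst (Adj x) eq (adj-sym y~x))) far
        adjacent k≤D (inj₂ e)  = e

        -- The two neighbours on `Q` of an inner vertex are two layers apart, so claw-freeness at
        -- that vertex makes `y` close to one of them, and `at-edge` applies.
        impossible : ∀ {k} → k ≤ D → ¬ Adj y (vertex Q k)
        impossible {zero}  _   e = at-start e
        impossible {suc j} k≤D e with m≤n⇒m<n∨m≡n k≤D
        ... | inj₂ refl = at-end e
        ... | inj₁ k<D with close? G (vertex Q j) y | close? G (vertex Q (2 + j)) y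
        ...   | yes c | _ =
          at-edge k≤D (adjacent (<⇒≤ k≤D) (close-sym G c)) e
        ...   | no _ | yes c = at-edge k<D e (adjacent k<D (close-sym G c))
        ...   | no ¬c | no ¬c′ =
          level-gap (level Q (<⇒≤ k≤D)) (level Q k<D) ≤-refl
            (no-claw (adj-sym (walk Q k≤D)) (walk Q k<D) (adj-sym e) ¬c ¬c′)

      decide : OnPath G x P ⊎ (∃[ y ] OnPath G y P × Adj x y)
      decide with dominated? Q x
      ... | yes (k , k< , inj₁ eq) = inj₁ (_ , sym (trans eq (Q≡ₖ k<)))
      ... | yes (k , k< , inj₂ e)  =
        inj₂ (_ , (_ , refl) , subst (Adj x) (Q≡ₖ k<) e)
      ... | no far with frontier Q _ refl far
      ...   | x′ , y , far′ , (k , k< , c) , y~x′ =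
        ⊥-elim (impossible far′ y~x′ (s≤s⁻¹ k<)
                 (adjacent far′ y~x′ (s≤s⁻¹ k<) c))

  -- Narrow graphs have a vertex from which all layers are cliques.

  Simplicial : V → Set
  Simplicial t = ∀ {u w} → Adj t u → Adj t w → Close G u w

  -- The closed neighbourhood of `t`, encoded as a `Subset` because strict inclusion there is
  -- well-founded.
  N[_] : V → Subset order
  N[ t ] = tabulate (λ v → does (close? G t v))

  ∈N⁺ : ∀ {t v} → Close G t v → v Subset.∈ N[ t ]
  ∈N⁺ {t} {v} c = lookup⇒[]= v _
    (trans (lookup∘tabulate _ v) (dec-true (close? G t v) c))

  ∈N⁻ : ∀ {t v} → v Subset.∈ N[ t ] → Close G t v
  ∈N⁻ {t} {v} v∈ = decidable-stable (close? G t v) λ ¬c →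
    contradiction (trans (sym ([]=⇒lookup v∈)) (trans (lookup∘tabulate _ v)
                    (dec-false (close? G t v) ¬c)))
                  λ ()

  CliqueLayers : V → Set
  CliqueLayers t = ∀ {u w} → dist t u ≡ dist t w → Close G u w

  module _ (narrow : Narrow G) {D} (bound : ∀ u v → dist u v ≤ D) where

    longest : ∀ {s} (P : Geodesic s D) → LongestShortest G (path P)
    longest {s} P = isDist , (s , vertex P D , isDist) ,
      λ u v d Δ → subst (_≤ D) (dist-unique Δ) (bound u v)
      where
      isDist : Distance G s (vertex P D) D
      isDist = path P , λ ℓ Q →
        subst (_≤ ℓ) (level P ≤-refl) (dist-least (path⇒reach Q))

    dominated : ∀ {s} (P : Geodesic s D) u → Dominated P u
    dominated P u with narrow u (path P) (longest P)
    ... | inj₁ (k , eq) = toℕ k , Fin.toℕ<n k , inj₁ (sym eq)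
    ... | inj₂ (y , (k , eq) , e) =
      toℕ k , Fin.toℕ<n k , inj₂ (subst (Adj u) (sym eq) e)

    -- A dominating vertex on level `3 + i` has `u` and `vertex P (2 + i)` as parents. One on level
    -- `1 + i` has both as neighbours, and its predecessor `vertex P i` would be the third leaf of a
    -- claw; this is why the level of `u` is at least 2.
    close-on-level : ∀ {s u i} (P : Geodesic s D) → dist s u ≡ 2 + i →
                     Close G u (vertex P (2 + i))
    close-on-level {s} {u} {i} P lu with dominated P u
    ... | k , s≤s k≤D , inj₁ eq =
      inj₁ (trans eq (cong (vertex P)
        (trans (sym (level P k≤D)) (trans (cong (dist s) (sym eq)) lu))))
    ... | k , s≤s k≤D , inj₂ e with neighbour-level e lu
    ...   | inj₁ lk with refl ← trans (sym (level P k≤D)) lk =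
      joined-above₂ lu (level P (<⇒≤ k≤D)) lk e (adj-sym (walk P k≤D))
    ...   | inj₂ (inj₁ lk) with refl ← trans (sym (level P k≤D)) lk = inj₂ e
    ...   | inj₂ (inj₂ lk)
      with refl ← trans (sym (level P k≤D)) (suc-injective lk) =
      no-claw (adj-sym e) (walk P 2+i≤D) (adj-sym (walk P k≤D))
        (gap lu) (gap (level P 2+i≤D))
      where
      2+i≤D : 2 + i ≤ D
      2+i≤D = subst (_≤ D) lu (bound s u)
      gap : ∀ {v} → dist s v ≡ 2 + i → ¬ Close G v (vertex P i)
      gap lv c = level-gap (level P (<⇒≤ k≤D)) lv ≤-refl (close-sym G c)

    -- A geodesic to `u`, continued along `P` from level `3 + i`, is again a longest one and passes
    -- through `u`.
    reroute : ∀ {s u w i} (P : Geodesic s D) →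
              dist s u ≡ 2 + i → dist s w ≡ 2 + i →
              Adj u (vertex P (3 + i)) → Close G w u
    reroute {u = u} {w} {i} P lu lw e with Q , Q≡u ← geodesic lu =
      subst (Close G w)
        (trans (splice-≤ (vertex Q) (vertex P) {2 + i} ≤-refl) Q≡u)
        (close-on-level
          (splice-geodesic Q (vertex P)
            (subst (λ v → Adj v (vertex P (3 + i))) (sym Q≡u) e)
            (λ _ → level P) (λ _ → walk P)) lw)

    -- Vertices on longest geodesics are close to their whole level, and
    -- claw-freeness at P (2 + i) allows P to be rerouted through u or w.
    level-clique : ∀ {s u w i} → Geodesic s D →
                   dist s u ≡ 2 + i → dist s w ≡ 2 + i → Close G u w
    level-clique {s} {u} {w} {i} P lu lw
      with m≤n⇒m<n∨m≡n (subst (_≤ D) lu (bound s u))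
    -- In the last layer, any geodesic to `u` is already a longest one.
    ... | inj₂ refl with Q , Q≡u ← geodesic lu =
      close-sym G (subst (Close G w) Q≡u (close-on-level Q lw))
    ... | inj₁ 2+i<D with close-on-level P lu | close-on-level P lw
    ...   | inj₁ refl | c = close-sym G c
    ...   | inj₂ u~p | inj₁ refl = inj₂ u~p
    ...   | inj₂ u~p | inj₂ w~p
      with adj? u (vertex P (3 + i)) | adj? w (vertex P (3 + i))
    ...     | yes u~p⁺ | _ = close-sym G (reroute P lu lw u~p⁺)
    ...     | no _ | yes w~p⁺ = reroute P lw lu w~p⁺
    ...     | no u≁p⁺ | no w≁p⁺ =
      no-claw (adj-sym u~p) (adj-sym w~p) (walk P 2+i<D)
        (λ { (inj₁ eq) → level-≢ lu (level P 2+i<D) (λ q → 1+n≢n (sym q)) eq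
           ; (inj₂ e)  → u≁p⁺ e })
        (λ { (inj₁ eq) → level-≢ lw (level P 2+i<D) (λ q → 1+n≢n (sym q)) eq
           ; (inj₂ e)  → w≁p⁺ e })

  module _ (narrow : Narrow G) {m} (bound : ∀ u v → dist u v ≤ 2 + m) where

    -- A neighbour `v` of `w` in the last layer is close to `t` because that layer is a clique. One
    -- in the layer below is adjacent to `u`, and the four-cycle `t`, `w`, `v`, `u` lacks the
    -- diagonal from `w` to `u`. The vertex `u` makes the inclusion strict.
    shrink : ∀ {s t u w} → dist s t ≡ 2 + m → Adj t u → Adj t w →
             ¬ Close G u w → dist s u ≡ 1 + m → dist s w ≡ 2 + m → N[ w ] ⊂ N[ t ]
    shrink {s} {t} {u} {w} lt t~u t~w ¬uw lu lw =
      (λ v∈ → ∈N⁺ (sub (∈N⁻ v∈))) ,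
      u , ∈N⁺ (inj₂ t~u) , λ u∈ → ¬uw (close-sym G (∈N⁻ u∈))
      where
      sub : ∀ {v} → Close G w v → Close G t v
      sub (inj₁ refl) = inj₂ t~w
      sub {v} (inj₂ w~v) with neighbour-level w~v lw
      ... | inj₁ lv = ⊥-elim (1+n≰n (subst (_≤ 2 + m) lv (bound s v)))
      ... | inj₂ (inj₁ lv) =
        level-clique narrow bound (proj₁ (geodesic lt)) lt lv
      ... | inj₂ (inj₂ 1+lv) with lv ← suc-injective 1+lv
        with joined-above₃ lv lu lw lt (adj-sym w~v) (adj-sym t~w) t~u
      ...   | inj₁ refl = ⊥-elim (¬uw (inj₂ (adj-sym w~v)))
      ...   | inj₂ v~u
        with four-cycle t~w w~v v~u (adj-sym t~u)
               (λ { refl → ¬uw (inj₁ refl) })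
      ...     | inj₁ c   = c
      ...     | inj₂ w~u = ⊥-elim (¬uw (inj₂ (adj-sym w~u)))

    -- Two neighbours of `t` that are not close lie in different layers, and the one in the last
    -- layer has a smaller closed neighbourhood than `t`; the search continues from there.
    simplicial-end : ∀ {s t} → Acc _⊂_ N[ t ] → dist s t ≡ 2 + m →
                     ∃[ t′ ] dist s t′ ≡ 2 + m × Simplicial t′
    simplicial-end {s} {t} (acc rs) lt
      with Fin.any? (λ u → Fin.any? (λ w →
             adj? t u ×-dec adj? t w ×-dec ¬? (close? G u w)))
    ... | no none = t , lt , λ {u} {w} t~u t~w →
      decidable-stable (close? G u w) (λ ¬uw → none (u , w , t~u , t~w , ¬uw))
    ... | yes (u , w , t~u , t~w , ¬uw)
      with neighbour-level t~u lt | neighbour-level t~w lt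
    ... | inj₁ lu | _ = ⊥-elim (1+n≰n (subst (_≤ 2 + m) lu (bound s u)))
    ... | _ | inj₁ lw = ⊥-elim (1+n≰n (subst (_≤ 2 + m) lw (bound s w)))
    ... | inj₂ (inj₁ lu) | inj₂ (inj₁ lw) = contradiction
      (level-clique narrow bound (proj₁ (geodesic lt)) lu lw) ¬uw
    ... | inj₂ (inj₂ lu) | inj₂ (inj₂ lw) = contradiction
      (joined-above₂ (suc-injective lu) (suc-injective lw) lt (adj-sym t~u) t~w) ¬uw
    ... | inj₂ (inj₂ lu) | inj₂ (inj₁ lw) = simplicial-end
      (rs (shrink lt t~u t~w ¬uw (suc-injective lu) lw)) lw
    ... | inj₂ (inj₁ lu) | inj₂ (inj₂ lw) = simplicial-end
      (rs (shrink lt t~w t~u (λ c → ¬uw (close-sym G c)) (suc-injective lw) lu)) lu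

    -- Layer 1 is the neighbourhood of `t`, a clique since `t` is simplicial; the higher layers are
    -- cliques since a longest geodesic starts at `t`.
    simplicial⇒cliqueLayers : ∀ {s t} → dist s t ≡ 2 + m → Simplicial t →
                              CliqueLayers t
    simplicial⇒cliqueLayers {s} {t} lt simp {u} {w} eq = go _ refl (sym eq)
      where
      go : ∀ k → dist t u ≡ k → dist t w ≡ dist t u → Close G u w
      go 0 lu lw = inj₁ (trans (sym (dist≡0 lu)) (dist≡0 (trans lw lu)))
      go 1 lu lw
        with a , a~u , la ← parent lu | b , b~w , lb ← parent (trans lw lu)
        with refl ← dist≡0 la | refl ← dist≡0 lb = simp a~u b~w
      go (suc (suc i)) lu lw =
        level-clique narrow bound (proj₁ (geodesic (trans (dist-sym t s) lt)))
          lu (trans lw lu)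

  farthest-pair : V → ∃[ s ] ∃[ t ] (∀ u v → dist u v ≤ dist s t)
  farthest-pair v₀ = proj₁ best , proj₂ best , λ u v →
    All.lookup (f[xs]≤f[argmax] (v₀ , v₀) pairs)
      (∈-cartesianProduct⁺ (∈-allFin u) (∈-allFin v))
    where
    pairs : List (V × V)
    pairs = cartesianProduct (allFin order) (allFin order)
    best : V × V
    best = argmax (uncurry dist) (v₀ , v₀) pairs

  narrow⇒cliqueLayers : Narrow G → V → ∃[ t ] CliqueLayers t
  narrow⇒cliqueLayers narrow v₀ with s , t , bound ← farthest-pair v₀ =
    go _ refl bound
    where
    dist≤1 : ∀ {u v} → dist u v ≤ 1 → Close G u v
    dist≤1 {u} {v} ≤1 with dist u v in eq
    ... | 0 = inj₁ (dist≡0 eq)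
    ... | 1 with a , a~v , la ← parent eq with refl ← dist≡0 la = inj₂ a~v
    dist≤1 (s≤s ()) | suc (suc _)
    go : ∀ D → dist s t ≡ D → (∀ u v → dist u v ≤ D) → ∃[ t ] CliqueLayers t
    -- With all distances at most 1 the graph is complete, and any vertex serves.
    go 0 _ bound = s , λ {u} {w} _ → dist≤1 (≤-trans (bound u w) z≤n)
    go 1 _ bound = s , λ {u} {w} _ → dist≤1 (bound u w)
    go (suc (suc m)) eq bound
      with t′ , lt , simp ← simplicial-end narrow bound (⊂-wellFounded N[ t ]) eq =
      t′ , simplicial⇒cliqueLayers narrow bound lt simp

  -- Clique layers exclude the net and the tent.

  module _ {t : V} (cliques : CliqueLayers t) (H : Graph)
           (H⊆G : ContainsInduced G H) where

    private
      f : Graph.V H → V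
      f = proj₁ H⊆G
      ℓ : Graph.V H → ℕ
      ℓ i = dist t (f i)

    adjacent-near : ∀ i j {_ : True (Graph.adj? H i j)} → Near (ℓ i) (ℓ j)
    adjacent-near i j {p} = dist-step (adj-sym e) , dist-step e
      where
      e : Adj (f i) (f j)
      e = Equivalence.to (proj₂ (proj₂ H⊆G) i j) (toWitness p)

    nonadjacent-≢ : ∀ i j {_ : False (i Fin.≟ j)} {_ : False (Graph.adj? H i j)} →
                    ℓ i ≢ ℓ j
    nonadjacent-≢ i j {p} {q} eq with cliques eq
    ... | inj₁ fi≡fj = toWitnessFalse p (proj₁ (proj₂ H⊆G) fi≡fj)
    ... | inj₂ e     = toWitnessFalse q (Equivalence.from (proj₂ (proj₂ H⊆G) i j) e)

  -- A triangle meets at most two layers, so some layer contains two or three of `a`, `b`, `c`.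
  -- Their pendants, with the remaining triangle vertex if it lies elsewhere, are three pairwise
  -- non-adjacent vertices competing for the two layers next to it.
  cliqueLayers⇒netFree : ∀ {t} → CliqueLayers t → NetFree G
  cliqueLayers⇒netFree {t} cliques net⊆G@(f , _) = go
    where
    ℓ : Fin 6 → ℕ
    ℓ i = dist t (f i)
    N : ∀ i j {_ : True (Graph.adj? net i j)} → Near (ℓ i) (ℓ j)
    N i j {p} = adjacent-near cliques net net⊆G i j {p}
    A : ∀ i j {_ : False (i Fin.≟ j)} {_ : False (Graph.adj? net i j)} → ℓ i ≢ ℓ j
    A i j {p} {q} = nonadjacent-≢ cliques net net⊆G i j {p} {q}
    a b c x y z : Fin 6
    a = # 0
    b = # 1
    c = # 2
    x = # 3
    y = # 4
    z = # 5
    go : ⊥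
    go with ℓ a ≟ ℓ b | ℓ a ≟ ℓ c | ℓ b ≟ ℓ c
    ... | yes ab | yes ac | _ = two-beside
      (N a x) (subst (λ k → Near k (ℓ y)) (sym ab) (N b y))
      (subst (λ k → Near k (ℓ z)) (sym ac) (N c z))
      (λ e → A x b (trans e ab)) (A y a) (A z a) (A x y) (A x z) (A y z)
    ... | yes ab | no ac | _ = two-beside
      (N a x) (subst (λ k → Near k (ℓ y)) (sym ab) (N b y)) (N a c)
      (λ e → A x b (trans e ab)) (A y a) (λ e → ac (sym e))
      (A x y) (A x c) (A y c)
    ... | no ab | yes ac | _ = two-beside
      (N a x) (subst (λ k → Near k (ℓ z)) (sym ac) (N c z)) (N a b)
      (λ e → A x c (trans e ac)) (A z a) (λ e → ab (sym e))
      (A x z) (A x b) (A z b)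
    ... | no ab | no _ | yes bc = two-beside
      (N b y) (subst (λ k → Near k (ℓ z)) (sym bc) (N c z)) (N b a)
      (λ e → A y c (trans e bc)) (A z b) ab
      (A y z) (A y a) (A z a)
    ... | no ab | no ac | no bc =
      bc (sym (near-both (N a b) (N a c) (N b c)
                (λ e → ab (sym e)) (λ e → ac (sym e))))

  -- If exactly two of `b`, `c`, `e` share a layer, both outer vertices adjacent to the third are
  -- forced into its layer, though they are not adjacent. If all three share one, `a`, `d`, `f`
  -- compete for the two layers next to it.
  cliqueLayers⇒tentFree : ∀ {t} → CliqueLayers t → TentFree G
  cliqueLayers⇒tentFree {t} cliques tent⊆G@(g , _) = go
    where
    ℓ : Fin 6 → ℕ
    ℓ i = dist t (g i)
    N : ∀ i j {_ : True (Graph.adj? tent i j)} → Near (ℓ i) (ℓ j)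
    N i j {p} = adjacent-near cliques tent tent⊆G i j {p}
    A : ∀ i j {_ : False (i Fin.≟ j)} {_ : False (Graph.adj? tent i j)} → ℓ i ≢ ℓ j
    A i j {p} {q} = nonadjacent-≢ cliques tent tent⊆G i j {p} {q}
    a b c d e f : Fin 6
    a = # 0
    b = # 1
    c = # 2
    d = # 3
    e = # 4
    f = # 5
    go : ⊥
    go with ℓ b ≟ ℓ c | ℓ b ≟ ℓ e | ℓ c ≟ ℓ e
    ... | yes bc | yes be | _ = two-beside
      (N b a) (subst (λ k → Near k (ℓ d)) (sym bc) (N c d)) (N b f)
      (λ q → A a e (trans q be)) (A d b) (λ q → A f c (trans q bc))
      (A a d) (A a f) (A d f)
    ... | yes bc | no be | _ = A d f (trans
      (near-both (N b e) (subst (λ k → Near k (ℓ d)) (sym bc) (N c d)) (N e d)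
                 (λ q → be (sym q)) (A d b))
      (sym (near-both (N b e) (N b f) (N e f)
                 (λ q → be (sym q)) (λ q → A f c (trans q bc)))))
    ... | no bc | yes be | _ = A a d (trans
      (near-both (N b c) (N b a) (N c a)
                 (λ q → bc (sym q)) (λ q → A a e (trans q be)))
      (sym (near-both (N b c) (subst (λ k → Near k (ℓ d)) (sym be) (N e d)) (N c d)
                 (λ q → bc (sym q)) (A d b))))
    ... | no bc | no be | yes ce = A a f (trans
      (near-both (N c b) (N c a) (N b a) bc (λ q → A a e (trans q ce)))
      (sym (near-both (N c b) (subst (λ k → Near k (ℓ f)) (sym ce) (N e f)) (N b f)
                 bc (A f c))))
    ... | no bc | no be | no ce =
      ce (sym (near-both (N b c) (N b e) (N c e)
                (λ q → bc (sym q)) (λ q → be (sym q))))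

theorem3p6 : (G : Graph) → Connected G → Chordal G → ClawFree G →
    Narrow G ⇔ (NetFree G × TentFree G)
theorem3p6 G connected chordal clawFree = mk⇔
  (λ narrow →
    -- The image of vertex 0 of the forbidden subgraph supplies the vertex that shows the graph to
    -- be nonempty.
    (λ H → cliqueLayers⇒netFree G connected chordal clawFree
             (proj₂ (layers narrow (proj₁ H (# 0)))) H) ,
    (λ H → cliqueLayers⇒tentFree G connected chordal clawFree
             (proj₂ (layers narrow (proj₁ H (# 0)))) H))
  (λ (netFree , tentFree) →
    netFree×tentFree⇒narrow G connected chordal clawFree netFree tentFree)
  where
  layers = narrow⇒cliqueLayers G connected chordal clawFree
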